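{- $\lambda(ABA.BCB.DCD.DED.AEA)=4$.
   Context: A formula is a finite set of non-empty words over variables (fragments), written separated by dots. An occurrence of a formula $f$ in a word $w$ over an alphabet $\Sigma$ is a non-erasing morphism $h$ from variables to non-empty words over $\Sigma$ such that $h(\phi)$ is a factor of $w$ for every fragment $\phi$; $\lambda(f)$ is the smallest size of an alphabet over which there exists an infinite word containing no occurrence of $f$. -}

module Defs where

open import Data.Nat using (ℕ; zero; suc; _+_; _<_; _≤_)
import Data.Fin
open import Data.Fin using (Fin; fromℕ<)
open import Data.List using (List; []; _∷_; length; lookup; concatMap)
open import Data.List.Relation.Unary.All using (All)
open import Data.Product using (Σ; ∃-syntax; _×_)
open import Relation.Binary.PropositionalEquality using (_≡_)
open import Relation.Nullary using (¬_)

InfWord : ℕ → Set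
InfWord k = ℕ → Fin k

Factor : ∀ {k} → List (Fin k) → InfWord k → Set
Factor u w = ∃[ i ] (∀ j (p : j < length u) → w (i + j) ≡ lookup u (fromℕ< p))

-- A formula over n variables: a finite list of fragments (words over Fin n).
-- (Non-emptiness of fragments is a property of the concrete formula below.)
Formula : ℕ → Set
Formula n = List (List (Fin n))

NonErasing : ∀ {n k} → (Fin n → List (Fin k)) → Set
NonErasing {n} h = (x : Fin n) → 1 ≤ length (h x)

image : ∀ {n k} → (Fin n → List (Fin k)) → List (Fin n) → List (Fin k)
image h φ = concatMap h φ

Occurrence : ∀ {n k} → Formula n → InfWord k → Set
Occurrence {n} {k} f w =
  Σ (Fin n → List (Fin k)) λ h → NonErasing h × All (λ φ → Factor (image h φ) w) f

Avoids : ∀ {n k} → Formula n → InfWord k → Set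
Avoids f w = ¬ Occurrence f w

IsAvoidabilityIndex : ∀ {n} → Formula n → ℕ → Set
IsAvoidabilityIndex f m =
  (Σ (InfWord m) λ w → Avoids f w) ×
  (∀ k → k < m → (w : InfWord k) → Occurrence f w)

vA vB vC vD vE : Fin 5
vA = Data.Fin.zero
vB = Data.Fin.suc Data.Fin.zero
vC = Data.Fin.suc (Data.Fin.suc Data.Fin.zero)
vD = Data.Fin.suc (Data.Fin.suc (Data.Fin.suc Data.Fin.zero))
vE = Data.Fin.suc (Data.Fin.suc (Data.Fin.suc (Data.Fin.suc Data.Fin.zero)))

f15 : Formula 5
f15 = (vA ∷ vB ∷ vA ∷ []) ∷ (vB ∷ vC ∷ vB ∷ []) ∷ (vD ∷ vC ∷ vD ∷ [])
    ∷ (vD ∷ vE ∷ vD ∷ []) ∷ (vA ∷ vE ∷ vA ∷ []) ∷ []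

{-# OPTIONS --safe #-}
module Submission where

-- Upper bound. Let b₄ n record the parity of n and the n-th letter of the paperfolding word.
-- Two occurrences in b₄ of a word of length at least 2^j are congruent mod 2^(j+1). Suppose f15
-- occurs and 2^j divides the lengths of all five images (true for j = 0). Then each image has a
-- well-defined position mod 2^(j+1), and following the odd cycle A B C D E through the fragments
-- gives |A| ≡ 0 and then |B|, |C|, |D|, |E| ≡ 0 mod 2^(j+1). So every power of 2 divides |A|.
--
-- Lower bound. By pigeonhole, every infinite word over k letters has a factor
-- (uZu)Y(uZu) with |u| as large as desired. If AD and DA are factors of u, and AEA and DED are
-- factors of the word, then B = D…D inside the first uZu and C = A…A between the two copies of B
-- complete an occurrence. A square AA in u is the case D = A; otherwise A, D, E are letters, and
-- an exhaustive search shows that one of these cases arises once |u| = 22 and k ≤ 3.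

open import Defs
open import Data.Bool using (Bool; true; false; T; _∧_; _∨_)
open import Data.Bool.ListAction using (all; any)
open import Data.Bool.Properties using (T-∧; T-∨)
open import Data.Fin using (Fin; zero; suc; toℕ; fromℕ<; combine; funToFin; finToFun)
open import Data.Fin.Properties using (toℕ-fromℕ<; combine-injective; pigeonhole; finToFun-funToFin; _≟_; toℕ≤pred[n])
open import Data.List using (List; []; _∷_; [_]; _++_; _∷ʳ_; length; lookup; applyUpTo; allFin; _ʳ++_; reverse)
open import Data.List.Membership.Propositional.Properties using (∈-allFin)
open import Data.List.Properties using (++-assoc; ++-identityʳ; ++-monoid; lookup-applyUpTo; length-applyUpTo; length-reverse; ʳ++-defn; reverse-involutive)
open import Data.List.Relation.Unary.All as All using ([]; _∷_)
open import Data.List.Relation.Unary.All.Properties using (all⁺)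
open import Data.List.Relation.Unary.Any as Any using ()
open import Data.List.Relation.Unary.Any.Properties using (any⁻)
open import Data.Nat using (ℕ; zero; suc; _+_; _*_; _^_; _≤_; _<_; s≤s; z<s; s<s; _%_; _/_; >-nonZero)
open import Data.Nat.Binary using (ℕᵇ; 2[1+_]; 1+[2_]) renaming (zero to 0ᵇ; toℕ to ⟦_⟧; fromℕ to bin)
open import Data.Nat.Binary.Properties using (toℕ-fromℕ; toℕ-injective)
open import Data.Nat.DivMod using (_mod_; m≡m%n+[m/n]*n; m%n<n; [m+kn]%n≡m%n)
open import Data.Nat.Divisibility using (_∣_; ∣m+n∣m⇒∣n; n∣m*n; ∣⇒≤; 1∣_)
open import Data.Nat.Properties using (+-assoc; +-comm; +-cancelˡ-≡; +-identityʳ; +-mono-≤; *-comm; *-distribʳ-+; *-cancelʳ-≡; *-monoˡ-≤; *-monoˡ-<; ≤-pred; ≤-trans; <⇒≱; m≤m+n; m^n>0; n<1+n; m≤n⇒∃[o]m+o≡n)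
open import Data.Nat.Tactic.RingSolver using (solve-∀)
open import Data.Product using (_×_; _,_; proj₁; proj₂; ∃; ∃₂)
open import Data.Sum using (_⊎_; inj₁; inj₂; [_,_]′)
open import Function using (_∘_; Equivalence)
open import Relation.Binary.PropositionalEquality using (_≡_; refl; sym; trans; cong; cong₂; subst; subst₂; module ≡-Reasoning)
open import Relation.Nullary.Decidable using (⌊_⌋; toWitness)
open import Tactic.MonoidSolver using () renaming (solve to solve-monoid)

-- Words at a given position

Begins : ∀ {k} → InfWord k → List (Fin k) → Set
Begins f u = ∀ j (p : j < length u) → f j ≡ lookup u (fromℕ< p)

begins-++ˡ : ∀ {k} {f : InfWord k} u {v} → Begins f (u ++ v) → Begins f u
begins-++ˡ (x ∷ u) b zero    p = b zero z<s
begins-++ˡ (x ∷ u) b (suc j) p = begins-++ˡ u (λ i q → b (suc i) (s<s q)) j (≤-pred p)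

begins-++ʳ : ∀ {k} {f : InfWord k} u {v} → Begins f (u ++ v) → Begins (f ∘ (length u +_)) v
begins-++ʳ []      b = b
begins-++ʳ (x ∷ u) b = begins-++ʳ u (λ i q → b (suc i) (s<s q))

-- By computation the field is the body of `Factor` at position `s`; wrapping it in a record lets
-- `s` be inferred.
record OccursAt {k} (w : InfWord k) (u : List (Fin k)) (s : ℕ) : Set where
  constructor occursAt
  field begins : Begins (w ∘ (s +_)) u

occursAt-++ʳ : ∀ {k} {w : InfWord k} u {v s} → OccursAt w (u ++ v) s → OccursAt w v (s + length u)
occursAt-++ʳ {w = w} u {s = s} (occursAt b) = occursAt λ j p →
  trans (cong w (+-assoc s (length u) j)) (begins-++ʳ u b j p)

occursAt-++ˡ : ∀ {k} {w : InfWord k} u {v s} → OccursAt w (u ++ v) s → OccursAt w u s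
occursAt-++ˡ u (occursAt b) = occursAt (begins-++ˡ u b)

-- Congruence of positions

infix 4 _≈_[mod_]
-- Adding multiples of `m` on both sides avoids subtraction in ℕ.
record _≈_[mod_] (s t m : ℕ) : Set where
  constructor congruent
  field
    k l : ℕ
    shifted : s + k * m ≡ t + l * m

m+n+o≡m+o+n : ∀ m n o → m + n + o ≡ m + o + n
m+n+o≡m+o+n = solve-∀

≈-trans : ∀ {m s t u} → s ≈ t [mod m ] → t ≈ u [mod m ] → s ≈ u [mod m ]
≈-trans {m} {s} {t} {u} (congruent k l e) (congruent k′ l′ e′) = congruent (k + k′) (l′ + l) (begin
  s + (k + k′) * m       ≡⟨ regroup s k k′ ⟩
  s + k * m + k′ * m     ≡⟨ cong (_+ k′ * m) e ⟩
  t + l * m + k′ * m     ≡⟨ m+n+o≡m+o+n t (l * m) (k′ * m) ⟩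
  t + k′ * m + l * m     ≡⟨ cong (_+ l * m) e′ ⟩
  u + l′ * m + l * m     ≡⟨ regroup u l′ l ⟨
  u + (l′ + l) * m       ∎)
  where
  open ≡-Reasoning
  regroup : ∀ s k l → s + (k + l) * m ≡ s + k * m + l * m
  regroup s k l = trans (cong (s +_) (*-distribʳ-+ m k l)) (sym (+-assoc s (k * m) (l * m)))

≈-+ʳ : ∀ {m s t} c → s ≈ t [mod m ] → s + c ≈ t + c [mod m ]
≈-+ʳ {m} {s} {t} c (congruent k l e) =
  congruent k l (trans (m+n+o≡m+o+n s c (k * m)) (trans (cong (_+ c) e) (m+n+o≡m+o+n t (l * m) c)))

≈-cancelˡ : ∀ {m s t} c → c + s ≈ c + t [mod m ] → s ≈ t [mod m ]
≈-cancelˡ {m} {s} {t} c (congruent k l e) = congruent k l (+-cancelˡ-≡ c _ _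
  (trans (sym (+-assoc c s (k * m))) (trans e (+-assoc c t (l * m)))))

∣m+n∣n⇒∣m : ∀ {d m n} → d ∣ m + n → d ∣ n → d ∣ m
∣m+n∣n⇒∣m {d} {m} {n} d∣m+n = ∣m+n∣m⇒∣n (subst (d ∣_) (+-comm m n) d∣m+n)

≈⇒∣ : ∀ {m} s {x} → s ≈ s + x [mod m ] → m ∣ x
≈⇒∣ {m} s {x} (congruent k l e) = ∣m+n∣n⇒∣m (subst (m ∣_) e′ (n∣m*n k)) (n∣m*n l)
  where
  e′ : k * m ≡ x + l * m
  e′ = +-cancelˡ-≡ s _ _ (trans e (+-assoc s x (l * m)))

r+x*2+k*[2*m] : ∀ r x k m → r + x * 2 + k * (2 * m) ≡ r + (x + k * m) * 2
r+x*2+k*[2*m] = solve-∀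

≈-scale : ∀ {m x y} r → x ≈ y [mod m ] → r + x * 2 ≈ r + y * 2 [mod 2 * m ]
≈-scale {m} {x} {y} r (congruent k l e) = congruent k l
  (trans (r+x*2+k*[2*m] r x k m) (trans (cong (λ z → r + z * 2) e) (sym (r+x*2+k*[2*m] r y l m))))

≈-unscale : ∀ {m x y} r → r + x * 2 ≈ r + y * 2 [mod 2 * m ] → x ≈ y [mod m ]
≈-unscale {m} {x} {y} r (congruent k l e) = congruent k l (*-cancelʳ-≡ _ _ 2 (+-cancelˡ-≡ r _ _
  (trans (sym (r+x*2+k*[2*m] r x k m)) (trans e (r+x*2+k*[2*m] r y l m)))))

≈⇒%2 : ∀ {m s t} → s ≈ t [mod 2 * m ] → s % 2 ≡ t % 2
≈⇒%2 {m} {s} {t} (congruent k l e) =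
  trans (sym (drop2 s k)) (trans (cong (_% 2) e) (drop2 t l))
  where
  ring : ∀ k m → k * (2 * m) ≡ k * m * 2
  ring = solve-∀
  drop2 : ∀ s k → (s + k * (2 * m)) % 2 ≡ s % 2
  drop2 s k = trans (cong (λ z → (s + z) % 2) (ring k m)) ([m+kn]%n≡m%n s (k * m) 2)

mod2⇒≈ : ∀ {s t} → s mod 2 ≡ t mod 2 → s ≈ t [mod 2 ]
-- Each side receives the other's quotient, so both become the common remainder plus twice
-- `s / 2 + t / 2`.
mod2⇒≈ {s} {t} e = congruent (t / 2) (s / 2) (begin
  s + t / 2 * 2                 ≡⟨ cong (_+ t / 2 * 2) (m≡m%n+[m/n]*n s 2) ⟩
  s % 2 + s / 2 * 2 + t / 2 * 2 ≡⟨ cong (λ r → r + s / 2 * 2 + t / 2 * 2) e% ⟩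
  t % 2 + s / 2 * 2 + t / 2 * 2 ≡⟨ m+n+o≡m+o+n (t % 2) (s / 2 * 2) (t / 2 * 2) ⟩
  t % 2 + t / 2 * 2 + s / 2 * 2 ≡⟨ cong (_+ s / 2 * 2) (m≡m%n+[m/n]*n t 2) ⟨
  t + s / 2 * 2                 ∎)
  where
  open ≡-Reasoning
  e% : s % 2 ≡ t % 2
  e% = trans (sym (toℕ-fromℕ< (m%n<n s 2))) (trans (cong toℕ e) (toℕ-fromℕ< (m%n<n t 2)))

-- The paperfolding word and recurrence in `b₄`

-- If n + 1 = 2^a (2i + 1), then letter n is i mod 2: an even n = 2i receives i mod 2, an odd n = 2x
-- + 1 inherits the letter of x. Binary numerals make this recursion structural.
foldᵇ : ℕᵇ → Fin 2
foldᵇ 0ᵇ       = zero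
foldᵇ 2[1+ x ] = suc ⟦ x ⟧ mod 2
foldᵇ 1+[2 x ] = foldᵇ x

paperfolding : InfWord 2
paperfolding n = foldᵇ (bin n)

paperfolding-even : ∀ i → paperfolding (i * 2) ≡ i mod 2
paperfolding-even zero    = refl
paperfolding-even (suc i) = trans
  (cong foldᵇ (toℕ-injective {x = bin (suc i * 2)} {y = 2[1+ bin i ]} (trans (toℕ-fromℕ (suc i * 2))
    (trans (*-comm (suc i) 2) (cong (λ z → 2 * suc z) (sym (toℕ-fromℕ i)))))))
  (cong (λ z → suc z mod 2) (toℕ-fromℕ i))

paperfolding-odd : ∀ i → paperfolding (suc (i * 2)) ≡ paperfolding i
paperfolding-odd i = cong foldᵇ (toℕ-injective {x = bin (suc (i * 2))} {y = 1+[2 bin i ]}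
  (trans (toℕ-fromℕ (suc (i * 2))) (cong suc (trans (*-comm i 2) (cong (2 *_) (sym (toℕ-fromℕ i)))))))

-- The offset `o` of the i-th odd position depends only on the parity `r` of the start, so it serves
-- two windows of equal parity at once.
odd-offset : ∀ {N} r → r < 2 → ∀ i → i < N →
  ∃₂ λ o (_ : o < 2 * N) → ∀ x → r + x * 2 + o ≡ suc ((x + i) * 2)
odd-offset {N} 0 _ i i<N =
  suc (i * 2) , subst (suc (suc (i * 2)) ≤_) (*-comm N 2) (*-monoˡ-≤ 2 i<N) , λ x → ring x i
  where
  ring : ∀ x i → x * 2 + suc (i * 2) ≡ suc ((x + i) * 2)
  ring = solve-∀
odd-offset {N} 1 _ i i<N =
  i * 2 , subst (i * 2 <_) (*-comm N 2) (*-monoˡ-< 2 i<N) , λ x → ring x i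
  where
  ring : ∀ x i → suc (x * 2) + i * 2 ≡ suc ((x + i) * 2)
  ring = solve-∀
odd-offset (suc (suc _)) (s≤s (s≤s ()))

-- s and t have the same parity, so the letters at the odd positions of the two windows form
-- equal windows of paperfolding, starting at s / 2 and t / 2; this gives the induction on j.
paperfolding-lift : ∀ j {s t} → s ≈ t [mod 2 ^ suc j ] →
  (∀ i → i < 2 ^ suc j → paperfolding (s + i) ≡ paperfolding (t + i)) →
  s ≈ t [mod 2 ^ suc (suc j) ]
paperfolding-lift j {s} {t} c a = subst₂ (_≈_[mod 2 ^ suc (suc j) ]) (sym s≡) (sym t≡)
  (lift j {x = s / 2} {y = t / 2} (m%n<n s 2) (subst₂ (_≈_[mod 2 ^ suc j ]) s≡ t≡ c)
    (λ i p → subst₂ (λ s t → paperfolding (s + i) ≡ paperfolding (t + i)) s≡ t≡ (a i p)))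
  where
  s≡ : s ≡ s % 2 + s / 2 * 2
  s≡ = m≡m%n+[m/n]*n s 2
  t≡ : t ≡ s % 2 + t / 2 * 2
  t≡ = trans (m≡m%n+[m/n]*n t 2) (cong (_+ t / 2 * 2) (sym (≈⇒%2 {2 ^ j} c)))
  lift : ∀ j {r x y} → r < 2 → r + x * 2 ≈ r + y * 2 [mod 2 ^ suc j ] →
    (∀ i → i < 2 ^ suc j → paperfolding (r + x * 2 + i) ≡ paperfolding (r + y * 2 + i)) →
    r + x * 2 ≈ r + y * 2 [mod 2 ^ suc (suc j) ]
  -- Of the two positions the one at offset `r` is even: it is 2(r + x), and its letter reveals the
  -- parity of x, raising the modulus from 2 to 4.
  lift zero {r} {x} {y} r<2 c a = ≈-scale {2} r (≈-cancelˡ r (mod2⇒≈ (begin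
    (r + x) mod 2                ≡⟨ paperfolding-even (r + x) ⟨
    paperfolding ((r + x) * 2)   ≡⟨ cong paperfolding (ring r x) ⟨
    paperfolding (r + x * 2 + r) ≡⟨ a r r<2 ⟩
    paperfolding (r + y * 2 + r) ≡⟨ cong paperfolding (ring r y) ⟩
    paperfolding ((r + y) * 2)   ≡⟨ paperfolding-even (r + y) ⟩
    (r + y) mod 2                ∎)))
    where
    open ≡-Reasoning
    ring : ∀ r x → r + x * 2 + r ≡ (r + x) * 2
    ring = solve-∀
  lift (suc j) {r} {x} {y} r<2 c a = ≈-scale {2 ^ suc (suc j)} r (paperfolding-lift j (≈-unscale {2 ^ suc j} {x} {y} r c) halved)
    where
    halved : ∀ i → i < 2 ^ suc j → paperfolding (x + i) ≡ paperfolding (y + i)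
    halved i p with o , o< , e ← odd-offset r r<2 i p = begin
      paperfolding (x + i)             ≡⟨ paperfolding-odd (x + i) ⟨
      paperfolding (suc ((x + i) * 2)) ≡⟨ cong paperfolding (e x) ⟨
      paperfolding (r + x * 2 + o)     ≡⟨ a o o< ⟩
      paperfolding (r + y * 2 + o)     ≡⟨ cong paperfolding (e y) ⟩
      paperfolding (suc ((y + i) * 2)) ≡⟨ paperfolding-odd (y + i) ⟩
      paperfolding (y + i)             ∎
      where open ≡-Reasoning

-- Up to renaming letters, the fixed point of 0 ↦ 01, 1 ↦ 21, 2 ↦ 03, 3 ↦ 23.
b₄ : InfWord 4
b₄ n = combine (n mod 2) (paperfolding n)

-- A single letter shows the parity. For longer words the first half gives the congruence one power
-- lower, and the paperfolding component of the whole word doubles the modulus.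
b₄-recurrence : ∀ j {s t} → (∀ i → i < 2 ^ j → b₄ (s + i) ≡ b₄ (t + i)) → s ≈ t [mod 2 ^ suc j ]
b₄-recurrence zero {s} {t} a = mod2⇒≈ (proj₁ (combine-injective (s mod 2) (paperfolding s) (t mod 2) (paperfolding t)
  (subst₂ (λ s t → b₄ s ≡ b₄ t) (+-identityʳ s) (+-identityʳ t) (a 0 z<s))))
b₄-recurrence (suc j) {s} {t} a = paperfolding-lift j
  (b₄-recurrence j (λ i p → a i (≤-trans p (m≤m+n (2 ^ j) _))))
  (λ i p → proj₂ (combine-injective ((s + i) mod 2) (paperfolding (s + i))
    ((t + i) mod 2) (paperfolding (t + i)) (a i p)))

occursAt-≈ : ∀ j {u s t} → 2 ^ j ≤ length u → OccursAt b₄ u s → OccursAt b₄ u t → s ≈ t [mod 2 ^ suc j ]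
occursAt-≈ j len (occursAt a) (occursAt b) = b₄-recurrence j
  (λ i p → trans (a i (≤-trans p len)) (sym (b i (≤-trans p len))))

-- The word `b₄` avoids the formula

-- The trailing `[]` is what `concatMap` leaves in the image of a fragment.
fragment : ∀ {k} {w : InfWord k} u v {s} → OccursAt w (u ++ v ++ u ++ []) s →
  OccursAt w u s × OccursAt w v (s + length u) × OccursAt w u (s + length u + length v)
fragment {w = w} u v {s} o = occursAt-++ˡ u o , occursAt-++ˡ v o₂ ,
  subst (λ z → OccursAt w z (s + length u + length v)) (++-identityʳ u) (occursAt-++ʳ v o₂)
  where o₂ = occursAt-++ʳ u o

b₄-avoids : Avoids f15 b₄
b₄-avoids (h , ne , (s₁ , o₁) ∷ (s₂ , o₂) ∷ (s₃ , o₃) ∷ (s₄ , o₄) ∷ (s₅ , o₅) ∷ []) =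
  -- Exponent j = |A|: 2^|A| would divide the positive number |A|, which is smaller.
  <⇒≱ (m<2^m (ℓ vA)) (∣⇒≤ {{>-nonZero (ne vA)}} (divisible (ℓ vA) vA))
  where
  ℓ : Fin 5 → ℕ
  ℓ x = length (h x)

  m<2^m : ∀ m → m < 2 ^ m
  m<2^m zero    = z<s
  m<2^m (suc m) = +-mono-≤ (m^n>0 2 m) (≤-trans (m<2^m m) (m≤m+n (2 ^ m) 0))

  divisible : ∀ j x → 2 ^ j ∣ ℓ x
  divisible zero    x = 1∣ ℓ x
  divisible (suc j) =
    let A₁ , B₁ , A₁′ = fragment (h vA) (h vB) {s₁} (occursAt o₁)
        B₂ , C₂ , B₂′ = fragment (h vB) (h vC) {s₂} (occursAt o₂)
        D₃ , C₃ , D₃′ = fragment (h vD) (h vC) {s₃} (occursAt o₃)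
        D₄ , E₄ , D₄′ = fragment (h vD) (h vE) {s₄} (occursAt o₄)
        A₅ , E₅ , A₅′ = fragment (h vA) (h vE) {s₅} (occursAt o₅)
        -- The walk goes from the first A of ABA to the second, which starts where B ends; B leads
        -- to the C of BCB, C to DCD, D to the E of DED, and E to AEA, whose first A ends where the
        -- first A of ABA does modulo 2^(j+1). Hence s₁ ≡ s₁ + |A|.
        A∣ = ≈⇒∣ s₁ (≈-trans (same vA A₁ A₁′)
               (≈-trans (≈-+ʳ (ℓ vB) (same vB B₁ B₂))
               (≈-trans (same vC C₂ C₃)
               (≈-trans (≈-+ʳ (ℓ vD) (same vD D₃ D₄))
               (≈-trans (same vE E₄ E₅)
                        (≈-+ʳ (ℓ vA) (same vA A₅ A₁)))))))
        -- A fragment xyx gives |x| + |y| ≡ 0, so divisibility spreads from A to its neighbours B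
        -- and E, then to C and D.
        B∣ = ∣m+n∣m⇒∣n (period vA vB A₁ A₁′) A∣
        C∣ = ∣m+n∣m⇒∣n (period vB vC B₂ B₂′) B∣
        D∣ = ∣m+n∣n⇒∣m (period vD vC D₃ D₃′) C∣
        E∣ = ∣m+n∣m⇒∣n (period vA vE A₅ A₅′) A∣
    in λ where
      zero                         → A∣
      (suc zero)                   → B∣
      (suc (suc zero))             → C∣
      (suc (suc (suc zero)))       → D∣
      (suc (suc (suc (suc zero)))) → E∣
    where
    same : ∀ x {s t} → OccursAt b₄ (h x) s → OccursAt b₄ (h x) t → s ≈ t [mod 2 ^ suc j ]
    same x = occursAt-≈ j (∣⇒≤ {{>-nonZero (ne x)}} (divisible j x))
    period : ∀ x y {s} → OccursAt b₄ (h x) s → OccursAt b₄ (h x) (s + ℓ x + ℓ y) →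
      2 ^ suc j ∣ ℓ x + ℓ y
    period x y {s} o o′ =
      ≈⇒∣ s (subst (s ≈_[mod 2 ^ suc j ]) (+-assoc s (ℓ x) (ℓ y)) (same x o o′))

-- Nested repetitions in every infinite word

infix 4 _⊑_
record _⊑_ {X : Set} (u v : List X) : Set where
  constructor between
  field
    before after : List X
    split        : v ≡ before ++ u ++ after

⊑-trans : ∀ {X : Set} {t u v : List X} → t ⊑ u → u ⊑ v → t ⊑ v
⊑-trans {X} {t} (between p q refl) (between p′ q′ refl) =
  between (p′ ++ p) (q ++ q′) (rearrange p′ p t q q′)
  where
  rearrange : ∀ p′ p t q q′ → p′ ++ (p ++ t ++ q) ++ q′ ≡ (p′ ++ p) ++ t ++ q ++ q′
  rearrange p′ p t q q′ = solve-monoid (++-monoid X)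

window : ∀ {k} → InfWord k → ℕ → ℕ → List (Fin k)
window w s n = applyUpTo (w ∘ (s +_)) n

applyUpTo-cong : ∀ {X : Set} {f g : ℕ → X} n → (∀ i → i < n → f i ≡ g i) →
  applyUpTo f n ≡ applyUpTo g n
applyUpTo-cong zero    e = refl
applyUpTo-cong (suc n) e = cong₂ _∷_ (e 0 z<s) (applyUpTo-cong n (λ i p → e (suc i) (s<s p)))

applyUpTo-+ : ∀ {X : Set} (f : ℕ → X) m n →
  applyUpTo f (m + n) ≡ applyUpTo f m ++ applyUpTo (f ∘ (m +_)) n
applyUpTo-+ f zero    n = refl
applyUpTo-+ f (suc m) n = cong (f 0 ∷_) (applyUpTo-+ (f ∘ suc) m n)

window-+ : ∀ {k} (w : InfWord k) s m n → window w s (m + n) ≡ window w s m ++ window w (s + m) n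
window-+ w s m n = trans (applyUpTo-+ (w ∘ (s +_)) m n)
  (cong (window w s m ++_) (applyUpTo-cong n (λ i _ → cong w (sym (+-assoc s m i)))))

⊑-window⇒Factor : ∀ {k} {w : InfWord k} {u} {s n} → u ⊑ window w s n → Factor u w
⊑-window⇒Factor {w = w} {u} {s} {n} (between p q e) =
  s + length p , OccursAt.begins (occursAt-++ˡ u (occursAt-++ʳ {w = w} p {s = s} (occursAt (subst (Begins f) e begins))))
  where
  f = w ∘ (s +_)
  begins : Begins f (applyUpTo f n)
  begins j j< = sym (trans (lookup-applyUpTo f n (fromℕ< j<)) (cong f (toℕ-fromℕ< j<)))

⊑-window-repeat : ∀ {k} (w : InfWord k) s i n d l → let u = window w (s + i) n in
  window w (s + i + n + d) n ≡ u →
  u ++ window w (s + i + n) d ++ u ⊑ window w s (i + (n + (d + (n + l))))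
⊑-window-repeat {k} w s i n d l u≡ = between P Q (begin
  window w s (i + (n + (d + (n + l))))
    ≡⟨ window-+ w s i _ ⟩
  P ++ window w (s + i) (n + (d + (n + l)))
    ≡⟨ cong (P ++_) (window-+ w (s + i) n _) ⟩
  P ++ U ++ window w (s + i + n) (d + (n + l))
    ≡⟨ cong (λ z → P ++ U ++ z) (window-+ w (s + i + n) d _) ⟩
  P ++ U ++ Z ++ window w (s + i + n + d) (n + l)
    ≡⟨ cong (λ z → P ++ U ++ Z ++ z) (window-+ w (s + i + n + d) n l) ⟩
  P ++ U ++ Z ++ window w (s + i + n + d) n ++ Q
    ≡⟨ cong (λ z → P ++ U ++ Z ++ z ++ Q) u≡ ⟩
  P ++ U ++ Z ++ U ++ Q
    ≡⟨ rearrange P U Z Q ⟩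
  P ++ (U ++ Z ++ U) ++ Q ∎)
  where
  open ≡-Reasoning
  P = window w s i
  U = window w (s + i) n
  Z = window w (s + i + n) d
  Q = window w (s + i + n + d + n) l
  rearrange : ∀ p u z q → p ++ u ++ z ++ u ++ q ≡ p ++ (u ++ z ++ u) ++ q
  rearrange p u z q = solve-monoid (++-monoid (Fin k))

-- Pigeonhole on k^n + 1 consecutive disjoint blocks, with `funToFin` numbering the k^n words of
-- length n.
equal-windows : ∀ {k} (w : InfWord k) s n → ∃₂ λ i j → i < j × j ≤ k ^ n ×
  window w (s + j * n) n ≡ window w (s + i * n) n
equal-windows {k} w s n =
  let i , j , i<j , e = pigeonhole (n<1+n (k ^ n)) code
  in toℕ i , toℕ j , i<j , toℕ≤pred[n] j , applyUpTo-cong n λ t t<n →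
     subst (λ z → w (s + toℕ j * n + z) ≡ w (s + toℕ i * n + z)) (toℕ-fromℕ< t<n)
       (decode j i (fromℕ< t<n) (sym e))
  where
  code : Fin (suc (k ^ n)) → Fin (k ^ n)
  code i = funToFin {n} (λ t → w (s + toℕ i * n + toℕ t))
  decode : ∀ i j t → code i ≡ code j → w (s + toℕ i * n + toℕ t) ≡ w (s + toℕ j * n + toℕ t)
  decode i j t e = trans (sym (finToFun-funToFin {n} _ t))
    (trans (cong (λ z → finToFun z t) e) (finToFun-funToFin {n} _ t))

-- The length of the enclosing window depends only on k and n, so such a window can itself be made
-- to recur.
repeated-window : ∀ {k} (w : InfWord k) s n → ∃₂ λ i Z →
  window w i n ++ Z ++ window w i n ⊑ window w s (suc (k ^ n) * n)
repeated-window {k} w s n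
  with i , j , i<j , j≤ , e ← equal-windows w s n
  with d , refl ← m≤n⇒∃[o]m+o≡n i<j
  with l , l≡ ← m≤n⇒∃[o]m+o≡n j≤
  = s + i * n , window w (s + i * n + n) (d * n) , subst (_ ⊑_)
      (cong (window w s) (trans (ring₂ i n d l) (cong (λ z → suc z * n) l≡)))
      (⊑-window-repeat w s (i * n) n (d * n) (l * n)
        (trans (cong (λ z → window w z n) (ring₁ s i n d)) e))
  where
  ring₁ : ∀ s i n d → s + i * n + n + d * n ≡ s + (suc i + d) * n
  ring₁ = solve-∀
  ring₂ : ∀ i n d l → i * n + (n + (d * n + (n + l * n))) ≡ suc (suc i + d + l) * n
  ring₂ = solve-∀

record Repeated {k} (w : InfWord k) (u : List (Fin k)) : Set where
  field
    Z Y     : List (Fin k)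
    factors : ∀ v → v ⊑ (u ++ Z ++ u) ++ Y ++ (u ++ Z ++ u) → Factor v w

exists-repeated : ∀ {k} (w : InfWord k) n → ∃ λ u → length u ≡ n × Repeated w u
exists-repeated {k} w n
  with i , Y , between P Q e ← repeated-window w 0 (suc (k ^ n) * n)
  with j , Z , between p q e′ ← repeated-window w i n
  = window w j n , length-applyUpTo _ n , record
    { Z = Z
    -- The two copies of the outer window each contain uZu between `p` and `q`; the new `Y` absorbs
    -- what lies between the two copies of uZu.
    ; Y = q ++ Y ++ p
    ; factors = λ _ v⊑ → ⊑-window⇒Factor {s = 0} (⊑-trans v⊑ (between (P ++ p) (q ++ Q)
        (trans e (trans (cong (λ V → P ++ (V ++ Y ++ V) ++ Q) e′)
          (rearrange P p q Y Q (window w j n ++ Z ++ window w j n))))))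
    }
  where
  rearrange : ∀ P p q Y Q x → P ++ ((p ++ x ++ q) ++ Y ++ (p ++ x ++ q)) ++ Q
                            ≡ (P ++ p) ++ (x ++ (q ++ Y ++ p) ++ x) ++ (q ++ Q)
  rearrange P p q Y Q x = solve-monoid (++-monoid (Fin k))

-- Occurrences from nested repetitions

nonEmpty-++ : ∀ {X : Set} (u : List X) {v} → 1 ≤ length u → 1 ≤ length (u ++ v)
nonEmpty-++ (_ ∷ _) _ = z<s

-- B = D…D is what separates the A's in AD…DA. Since B recurs, a word C separating two
-- copies of B is both preceded and followed by D.
commuting⇒occurrence : ∀ {k} {w : InfWord k} {u} → Repeated w u → ∀ A D E →
  1 ≤ length A → 1 ≤ length D → 1 ≤ length E → A ++ D ⊑ u → D ++ A ⊑ u →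
  Factor (A ++ E ++ A ++ []) w → Factor (D ++ E ++ D ++ []) w → Occurrence f15 w
commuting⇒occurrence {k} {w} {u} rep A D E A≥1 D≥1 E≥1 (between p q e) (between p′ q′ e′) AEA DED =
  h , nonErasing ,
  factors (image h (vA ∷ vB ∷ vA ∷ [])) (between p _ (trans expand (ABA A D p q p′ q′ Z Y))) ∷
  factors (image h (vB ∷ vC ∷ vB ∷ [])) (between (p ++ A) (A ++ q′) (trans expand (BCB A D p q p′ q′ Z Y))) ∷
  factors (image h (vD ∷ vC ∷ vD ∷ [])) (between (p ++ A ++ D ++ q ++ Z ++ p′) _ (trans expand (DCD A D p q p′ q′ Z Y))) ∷
  DED ∷ AEA ∷ []
  where
  open Repeated rep

  h : Fin 5 → List (Fin k)
  h zero                         = A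
  h (suc zero)                   = D ++ q ++ Z ++ p′ ++ D
  h (suc (suc zero))             = A ++ q′ ++ Y ++ p ++ A
  h (suc (suc (suc zero)))       = D
  h (suc (suc (suc (suc zero)))) = E

  nonErasing : NonErasing h
  nonErasing zero                         = A≥1
  nonErasing (suc zero)                   = nonEmpty-++ D D≥1
  nonErasing (suc (suc zero))             = nonEmpty-++ A A≥1
  nonErasing (suc (suc (suc zero)))       = D≥1
  nonErasing (suc (suc (suc (suc zero)))) = E≥1

  -- In each uZu the left u is cut around AD and the right u around DA, so B runs across Z and C
  -- across Y.
  expand : (u ++ Z ++ u) ++ Y ++ (u ++ Z ++ u) ≡
    ((p ++ (A ++ D) ++ q) ++ Z ++ (p′ ++ (D ++ A) ++ q′)) ++ Y ++
    ((p ++ (A ++ D) ++ q) ++ Z ++ (p′ ++ (D ++ A) ++ q′))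
  expand = cong (λ V → V ++ Y ++ V) (cong₂ (λ x y → x ++ Z ++ y) e e′)

  module _ (A D p q p′ q′ Z Y : List (Fin k)) where
    ABA : ((p ++ (A ++ D) ++ q) ++ Z ++ (p′ ++ (D ++ A) ++ q′)) ++ Y ++
          ((p ++ (A ++ D) ++ q) ++ Z ++ (p′ ++ (D ++ A) ++ q′)) ≡
      p ++ (A ++ (D ++ q ++ Z ++ p′ ++ D) ++ A ++ []) ++
      (q′ ++ Y ++ (p ++ (A ++ D) ++ q) ++ Z ++ (p′ ++ (D ++ A) ++ q′))
    ABA = solve-monoid (++-monoid (Fin k))
    BCB : ((p ++ (A ++ D) ++ q) ++ Z ++ (p′ ++ (D ++ A) ++ q′)) ++ Y ++
          ((p ++ (A ++ D) ++ q) ++ Z ++ (p′ ++ (D ++ A) ++ q′)) ≡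
      (p ++ A) ++
      ((D ++ q ++ Z ++ p′ ++ D) ++ (A ++ q′ ++ Y ++ p ++ A) ++ (D ++ q ++ Z ++ p′ ++ D) ++ []) ++
      (A ++ q′)
    BCB = solve-monoid (++-monoid (Fin k))
    DCD : ((p ++ (A ++ D) ++ q) ++ Z ++ (p′ ++ (D ++ A) ++ q′)) ++ Y ++
          ((p ++ (A ++ D) ++ q) ++ Z ++ (p′ ++ (D ++ A) ++ q′)) ≡
      (p ++ A ++ D ++ q ++ Z ++ p′) ++ (D ++ (A ++ q′ ++ Y ++ p ++ A) ++ D ++ []) ++
      (q ++ Z ++ (p′ ++ (D ++ A) ++ q′))
    DCD = solve-monoid (++-monoid (Fin k))

HasSquare : ∀ {k} → List (Fin k) → Set
HasSquare u = ∃ λ A → 1 ≤ length A × A ++ A ⊑ u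

-- With D = A the conditions on AEA and DED coincide. The word E reaches across Z, from the second A
-- of the square in the left u to the first A of that in the right u.
square⇒occurrence : ∀ {k} {w : InfWord k} {u} → Repeated w u → HasSquare u → Occurrence f15 w
square⇒occurrence {k} {w} {u} rep (A , A≥1 , AA@(between p q e)) =
  commuting⇒occurrence rep A A E A≥1 A≥1 (nonEmpty-++ A A≥1) AA AA AEA AEA
  where
  open Repeated rep
  E : List (Fin k)
  E = A ++ q ++ Z ++ p ++ A
  rearrange : ∀ A p q Z X → ((p ++ (A ++ A) ++ q) ++ Z ++ (p ++ (A ++ A) ++ q)) ++ X ≡
    p ++ (A ++ (A ++ q ++ Z ++ p ++ A) ++ A ++ []) ++ (q ++ X)
  rearrange A p q Z X = solve-monoid (++-monoid (Fin k))
  AEA : Factor (A ++ E ++ A ++ []) w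
  AEA = factors (A ++ E ++ A ++ []) (between p _ (trans (cong (λ z → (z ++ Z ++ z) ++ Y ++ u ++ Z ++ u) e)
    (rearrange A p q Z (Y ++ u ++ Z ++ u))))

HasLetterPair : ∀ {k} → List (Fin k) → Set
HasLetterPair {k} u = ∃₂ λ (a d : Fin k) → ∃ λ e →
  a ∷ e ∷ a ∷ [] ⊑ u × d ∷ e ∷ d ∷ [] ⊑ u × a ∷ d ∷ [] ⊑ u × d ∷ a ∷ [] ⊑ u

letterPair⇒occurrence : ∀ {k} {w : InfWord k} {u} → Repeated w u → HasLetterPair u → Occurrence f15 w
letterPair⇒occurrence {w = w} {u} rep (a , d , e , aea , ded , ad , da) =
  commuting⇒occurrence rep [ a ] [ d ] [ e ] z<s z<s z<s ad da (factor aea) (factor ded)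
  where
  open Repeated rep
  factor : ∀ {v} → v ⊑ u → Factor v w
  factor {v} i = factors v (⊑-trans i (between [] _ (++-assoc u (Z ++ u) _)))

-- Exhaustive search

module _ {k : ℕ} where

  isPrefix : List (Fin k) → List (Fin k) → Bool
  isPrefix []      _       = true
  isPrefix (_ ∷ _) []      = false
  isPrefix (x ∷ u) (y ∷ v) = ⌊ x ≟ y ⌋ ∧ isPrefix u v

  isInfix : List (Fin k) → List (Fin k) → Bool
  isInfix u []          = isPrefix u []
  isInfix u v@(_ ∷ v′) = isPrefix u v ∨ isInfix u v′

  -- The candidate half `u` takes letters from the rest one at a time, so every half length is
  -- tried.
  squareFrom : List (Fin k) → List (Fin k) → Bool
  squareFrom u []      = false
  squareFrom u (x ∷ v) = isPrefix u (x ∷ v) ∨ squareFrom (u ∷ʳ x) v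

  -- Words grow on the left, so a square not seen earlier is a prefix.
  startsWithSquare : List (Fin k) → Bool
  startsWithSquare []      = false
  startsWithSquare (x ∷ u) = squareFrom [ x ] u

  isLetterPair : Fin k → Fin k → Fin k → List (Fin k) → Bool
  isLetterPair a d e u =
    (isInfix (a ∷ e ∷ a ∷ []) u ∧ isInfix (d ∷ e ∷ d ∷ []) u) ∧
    (isInfix (a ∷ d ∷ []) u ∧ isInfix (d ∷ a ∷ []) u)

  -- Words grow on the left, so for a pair not seen earlier one of ad, da, aea, ded is a prefix;
  -- the symmetry between a and d leaves the two cases tested.
  hasNewLetterPair : List (Fin k) → Bool
  hasNewLetterPair u@(x ∷ y ∷ _) =
    any (λ e → isLetterPair x y e u) (allFin k) ∨ any (λ d → isLetterPair x d y u) (allFin k)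
  hasNewLetterPair _ = false

  -- Here `n` counts the letters still to be added. A branch closes at its first square or pair,
  -- since every extension keeps it as an infix.
  search : ℕ → List (Fin k) → Bool
  extend : ℕ → List (Fin k) → Bool
  search n v = startsWithSquare v ∨ (hasNewLetterPair v ∨ extend n v)
  -- A word of full length with neither a square nor a pair makes the search fail.
  extend zero    v = false
  extend (suc n) v = all (λ x → search n (x ∷ v)) (allFin k)

  isPrefix-sound : ∀ u v → T (isPrefix u v) → ∃ λ q → v ≡ u ++ q
  isPrefix-sound []      v       _ = v , refl
  isPrefix-sound (x ∷ u) (y ∷ v) t with x≟y , t′ ← Equivalence.to (T-∧ {⌊ x ≟ y ⌋}) t
    with refl ← toWitness {a? = x ≟ y} x≟y with q , refl ← isPrefix-sound u v t′ = q , refl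

  isInfix-sound : ∀ u v → T (isInfix u v) → u ⊑ v
  isInfix-sound u []      t with q , e ← isPrefix-sound u [] t = between [] q e
  isInfix-sound u (x ∷ v) t with Equivalence.to T-∨ t
  ... | inj₁ t′ with q , e ← isPrefix-sound u (x ∷ v) t′ = between [] q e
  ... | inj₂ t′ with between p q refl ← isInfix-sound u v t′ = between (x ∷ p) q refl

  squareFrom-sound : ∀ u v → 1 ≤ length u → T (squareFrom u v) → HasSquare (u ++ v)
  squareFrom-sound u (x ∷ v) u≥1 t with Equivalence.to T-∨ t
  ... | inj₁ t′ with q , e ← isPrefix-sound u (x ∷ v) t′ =
    u , u≥1 , between [] q (trans (cong (u ++_) e) (sym (++-assoc u u q)))
  ... | inj₂ t′ = subst HasSquare (++-assoc u [ x ] v)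
    (squareFrom-sound (u ∷ʳ x) v (nonEmpty-++ u u≥1) t′)

  startsWithSquare-sound : ∀ u → T (startsWithSquare u) → HasSquare u
  startsWithSquare-sound (x ∷ u) t = squareFrom-sound [ x ] u z<s t

  isLetterPair-sound : ∀ a d e u → T (isLetterPair a d e u) → HasLetterPair u
  isLetterPair-sound a d e u t =
    let aea∧ded , ad∧da = Equivalence.to T-∧ t
        aea , ded = Equivalence.to T-∧ aea∧ded
        ad , da = Equivalence.to T-∧ ad∧da
    in a , d , e , isInfix-sound _ u aea , isInfix-sound _ u ded ,
       isInfix-sound _ u ad , isInfix-sound _ u da

  hasNewLetterPair-sound : ∀ u → T (hasNewLetterPair u) → HasLetterPair u
  hasNewLetterPair-sound u@(x ∷ y ∷ _) t with Equivalence.to T-∨ t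
  ... | inj₁ t′ = let e , p = Any.satisfied (any⁻ _ (allFin k) t′) in isLetterPair-sound x y e u p
  ... | inj₂ t′ = let d , p = Any.satisfied (any⁻ _ (allFin k) t′) in isLetterPair-sound x d y u p

  ⊑-ʳ++ : ∀ {u v : List (Fin k)} t → u ⊑ v → u ⊑ t ʳ++ v
  ⊑-ʳ++ {v = v} t i = ⊑-trans i (between (reverse t) []
    (trans (ʳ++-defn t) (cong (reverse t ++_) (sym (++-identityʳ v)))))

  -- The list `t` is a path in the search tree, its letters in the order in which they are put in
  -- front of `v`; hence the word reached is `t ʳ++ v`.
  search-sound : ∀ n v → T (search n v) → ∀ t → length t ≡ n →
    HasSquare (t ʳ++ v) ⊎ HasLetterPair (t ʳ++ v)
  search-sound n v s t len with Equivalence.to (T-∨ {startsWithSquare v}) s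
  ... | inj₁ s′ = let A , A≥1 , AA = startsWithSquare-sound v s′ in inj₁ (A , A≥1 , ⊑-ʳ++ t AA)
  ... | inj₂ s′ with Equivalence.to (T-∨ {hasNewLetterPair v}) s′
  ...   | inj₁ s″ =
    let a , d , e , aea , ded , ad , da = hasNewLetterPair-sound v s″
    in inj₂ (a , d , e , ⊑-ʳ++ t aea , ⊑-ʳ++ t ded , ⊑-ʳ++ t ad , ⊑-ʳ++ t da)
  search-sound (suc n) v s (x ∷ t) refl | inj₂ s′ | inj₂ s″ =
    search-sound n (x ∷ v) (All.lookup (all⁺ _ (allFin k) s″) (∈-allFin x)) t refl

-- The lower bound

repeated⇒occurrence : ∀ {k n} {w : InfWord k} {u} → search {k} n [] ≡ true → length u ≡ n →
  Repeated w u → Occurrence f15 w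
repeated⇒occurrence {n = n} {u = u} found len rep =
  [ square⇒occurrence rep ∘ subst HasSquare (reverse-involutive u)
  , letterPair⇒occurrence rep ∘ subst HasLetterPair (reverse-involutive u) ]′
  -- The search builds u from its last letter to its first, so its path is `reverse u`.
  (search-sound n [] (subst T (sym found) _) (reverse u) (trans (length-reverse u) len))

search⇒occurrence : ∀ {k} n → search {k} n [] ≡ true → (w : InfWord k) → Occurrence f15 w
search⇒occurrence n found w =
  let _ , len , rep = exists-repeated w n in repeated⇒occurrence {n = n} found len rep

f15-unavoidable : ∀ k → k < 4 → (w : InfWord k) → Occurrence f15 w
-- Each length is a depth at which the search closes by evaluation: over no letters already the
-- first extension is vacuous, one letter forces a square at length 2, and two letters at length 4.
-- Squares can be avoided over three letters, where the letter pairs are essential.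
f15-unavoidable 0 _ = search⇒occurrence {0} 1 refl
f15-unavoidable 1 _ = search⇒occurrence {1} 2 refl
f15-unavoidable 2 _ = search⇒occurrence {2} 4 refl
f15-unavoidable 3 _ = search⇒occurrence {3} 22 refl
f15-unavoidable (suc (suc (suc (suc _)))) (s≤s (s≤s (s≤s (s≤s ()))))

theorem15 : IsAvoidabilityIndex f15 4
theorem15 = (b₄ , b₄-avoids) , f15-unavoidable
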